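{- Let $(\mathcal{A},\mathbf{m})$ be a cyclic sequencing problem with $n=2$. Suppose $m_k\nmid N$ for some symbol $a_k\in\mathcal{A}$, and let $\ell_k:=\lfloor N/m_k\rfloor$ and $u_k:=\lceil N/m_k\rceil$. Then there exists a cycle $C\in\Omega(\mathcal{A},\mathbf{m})$ with $N_{\ell,k}:=m_ku_k-N$ instances of symbol $a_k$ with $\Delta_j=\ell_k$, along with $N_{u,k}:=N-m_k\ell_k$ instances of symbol $a_k$ with $\Delta_j=u_k$. Any such cycle $C$ minimizes, over $\Omega(\mathcal{A},\mathbf{m})$, the $(2,k)$th sub-moment $\mathcal{M}_2(a_k)$ for symbol $a_k$.
   Context: Here $\mathbb{N}=\{1,2,\ldots\}$. A cyclic sequencing problem is a couple $(\mathcal{A},\mathbf{m})$, where $\mathcal{A}=[a_1,\ldots,a_n]$ is an alphabet of $n$ distinct symbols and $\mathbf{m}=(m_1,\ldots,m_n)\in\mathbb{N}^n$ is the vector of prescribed multiplicities. Put $N:=\sum_{k=1}^n m_k$ and $\mathbb{Z}_N:=\mathbb{Z}/N\mathbb{Z}$. A cycle is a map $C:\mathbb{Z}_N\to\mathcal{A}$, with $C_j:=C([j]_N)$; $\mathcal{J}_k:=C^{ -1}(a_k)$, and the positions in $\mathcal{J}_k$ are the instances of $a_k$. A cycle is admissible if $|\mathcal{J}_k|=m_k$ for all $k$, and $\Omega(\mathcal{A},\mathbf{m})$ is the set of admissible cycles. For a cycle $C$ and a position $j$, $\Delta_j$ is the distance in steps from position $j$ to the next instance of the same symbol around the cycle,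 i.e. the least integer $d\ge 1$ with $C_{j+d}=C_j$ (indices modulo $N$); so $\Delta_j=N$ if the symbol appears only once. The $(p,k)$th sub-moment of $C$ is $\mathcal{M}_p(a_k):=\frac1N\sum_{j\in\mathcal{J}_k}\Delta_j^p$. -}

module Defs where

open import Data.Fin.Base using (Fin; zero; suc; toℕ)
import Data.Fin.Properties as Fin
open import Data.Integer.Base as ℤ using (ℤ; +_)
import Data.Integer.Properties as ℤ
open import Data.List.Base using (List; allFin; filter; length; map)
open import Data.Nat.Base
open import Data.Nat.DivMod using (_mod_; [m+n]%n≡m%n; m<n⇒m%n≡m)
open import Data.Nat.ListAction using (sum)
open import Data.Nat.Properties
open import Data.Product.Base using (∃; _×_; _,_; proj₁)
open import Data.Rational.Unnormalised.Base as ℚᵘ using (ℚᵘ; floor; ceiling)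
open import Data.Vec.Base as Vec using (Vec; _∷_; lookup)
open import Level using (Level)
open import Relation.Binary.PropositionalEquality
open import Relation.Nullary using (yes; no; contradiction)
open import Relation.Nullary.Decidable using (_×-dec_)
open import Relation.Unary using (Pred; Decidable)

private
  variable
    ℓ₀ : Level
    n : ℕ

IsLeast : Pred ℕ ℓ₀ → Pred ℕ ℓ₀
IsLeast P d = P d × (∀ e → P e → d ≤ e)

least : {P : Pred ℕ ℓ₀} → Decidable P → ∀ w → P w → ∃ (IsLeast P)
least P? zero p = zero , p , λ _ _ → z≤n
least {P = P} P? (suc w) p with P? zero
... | yes p₀ = zero , p₀ , λ _ _ → z≤n
... | no ¬p₀ with least (λ d → P? (suc d)) w p
...   | d , q , min = suc d , q , min′
  where
  min′ : ∀ e → P e → suc d ≤ e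
  min′ zero    r = contradiction r ¬p₀
  min′ (suc e) r = s≤s (min e r)

sum-nonZero : .{{NonZero n}} → (m : Vec ℕ n) → (∀ k → NonZero (lookup m k)) → NonZero (Vec.sum m)
sum-nonZero (x ∷ m) pos =
  >-nonZero (≤-trans (>-nonZero⁻¹ x {{pos zero}}) (m≤m+n x (Vec.sum m)))

-- The symbol a_k is represented by its index k, so the alphabet is Fin n.
record CyclicSequencingProblem (n : ℕ) .{{_ : NonZero n}} : Set where
  field
    multiplicities : Vec ℕ n
    positive       : ∀ k → NonZero (lookup multiplicities k)

  m : Fin n → ℕ
  m = lookup multiplicities

  N : ℕ
  N = Vec.sum multiplicities

  instance
    m-nonZero : ∀ {k} → NonZero (m k)
    m-nonZero {k} = positive k

    N-nonZero : NonZero N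
    N-nonZero = sum-nonZero multiplicities positive

  -- Fin N serves as ℤ/Nℤ; natural-number positions are reduced by `at` below.
  Cycle : Set
  Cycle = Fin N → Fin n

  at : Cycle → ℕ → Fin n
  at C j = C (j mod N)

  -- Each position is listed exactly once, so `length` is the cardinality.
  instances : Cycle → Fin n → List (Fin N)
  instances C k = filter (λ j → C j Fin.≟ k) (allFin N)

  Admissible : Cycle → Set
  Admissible C = ∀ k → length (instances C k) ≡ m k

  Recurs : Cycle → Fin N → Pred ℕ _
  Recurs C j d = 1 ≤ d × at C (toℕ j + d) ≡ C j

  recurs? : ∀ C j → Decidable (Recurs C j)
  recurs? C j d = (1 ≤? d) ×-dec (at C (toℕ j + d) Fin.≟ C j)

  recurs-N : ∀ C j → Recurs C j N
  recurs-N C j = >-nonZero⁻¹ N ,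
    cong C (Fin.toℕ-injective (trans (Fin.toℕ-fromℕ< _)
      (trans ([m+n]%n≡m%n (toℕ j) N) (m<n⇒m%n≡m (Fin.toℕ<n j)))))

  next : ∀ C j → ∃ (IsLeast (Recurs C j))
  next C j = least (recurs? C j) N (recurs-N C j)

  Δ : Cycle → Fin N → ℕ
  Δ C j = proj₁ (next C j)

  subMoment : ℕ → Cycle → Fin n → ℚᵘ
  subMoment p C k = + sum (map (λ j → Δ C j ^ p) (instances C k)) ℚᵘ./ N

  ℓ : Fin n → ℤ
  ℓ k = floor (+ N ℚᵘ./ m k)

  u : Fin n → ℤ
  u k = ceiling (+ N ℚᵘ./ m k)

  Nℓ : Fin n → ℤ
  Nℓ k = + m k ℤ.* u k ℤ.- + N

  Nu : Fin n → ℤ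
  Nu k = + N ℤ.- + m k ℤ.* ℓ k

  countΔ : Cycle → Fin n → ℤ → ℕ
  countΔ C k d = length (filter (λ j → + Δ C j ℤ.≟ d) (instances C k))

  Balanced : Cycle → Fin n → Set
  Balanced C k = + countΔ C k (ℓ k) ≡ Nℓ k × + countΔ C k (u k) ≡ Nu k

  MinimizesSubMoment : ℕ → Cycle → Fin n → Set
  MinimizesSubMoment p C k =
    ∀ C′ → Admissible C′ → subMoment p C k ℚᵘ.≤ subMoment p C′ k

{-# OPTIONS --safe #-}

-- The gaps Δ_j of a symbol with m instances add up to N, so they average N / m.
-- With q = ⌊N / m⌋ every natural d satisfies (d − q)(d − q − 1) ≥ 0, that is
-- (2q + 1) d ≤ d² + q (q + 1), with equality exactly for d ∈ {q, q + 1}.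
-- Summing over the instances bounds the second moment from below, and the bound
-- is attained when all gaps are q or q + 1.  Given that m and N are fixed, this
-- is equivalent to the prescribed counts of both gaps.  An example is the
-- Beatty-type cycle, which puts an instance at j iff ⌊(j + 1) m / N⌋ > ⌊j m / N⌋.
-- The symbol other than a_k fills the remaining positions.
module Submission where

open import Defs
open import Data.Fin.Base using (Fin; zero; suc; toℕ; opposite)
import Data.Fin.Properties as Fin
open import Data.Integer.Base as ℤ using (+_)
import Data.Integer.Properties as ℤ
open import Data.List.Base using (List; []; _∷_; allFin; filter; length; map; tabulate)
open import Data.List.Properties using (filter-all; filter-notAll; length-tabulate)
open import Data.List.Relation.Unary.All as All using (All; []; _∷_)
open import Data.List.Relation.Unary.All.Properties using (all-filter; ¬All⇒Any¬)
open import Data.Nat.Base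
open import Data.Nat.Divisibility using (_∤_; m%n≡0⇒n∣m; n∣m*n)
open import Data.Nat.DivMod
open import Data.Nat.ListAction using (sum)
open import Data.Nat.Properties
open import Data.Nat.Tactic.RingSolver using (solve-∀)
open import Data.Product.Base using (∃; _×_; _,_; proj₁; proj₂)
open import Data.Rational.Unnormalised.Base as ℚᵘ using (floor; ceiling)
open import Data.Sum.Base as Sum using (_⊎_; inj₁; inj₂; [_,_]′)
open import Data.Vec.Base as Vec using (Vec; []; _∷_; lookup)
open import Function.Base using (id; _∘_; const)
open import Level using (Level)
open import Relation.Binary.PropositionalEquality
open import Relation.Nullary using (Dec; yes; no; ¬_; contradiction)
open import Relation.Unary using (Pred; Decidable; _∪_)
open import Relation.Unary.Properties using (_∪?_)

private
  variable
    a b p : Level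
    A : Set a
    n : ℕ

-- Least elements of predicates on the natural numbers.

IsLeast-unique : {P : Pred ℕ a} {Q : Pred ℕ b} → (∀ d → P d → Q d) → (∀ d → Q d → P d) →
                 ∀ {d e} → IsLeast P d → IsLeast Q e → d ≡ e
IsLeast-unique P⊆Q Q⊆P (Pd , minP) (Qe , minQ) =
  ≤-antisym (minP _ (Q⊆P _ Qe)) (minQ _ (P⊆Q _ Pd))

-- Passes from distances counted from the next position to distances counted from the current one,
-- where 0 is excluded.
IsLeast-suc : {P : Pred ℕ a} → ¬ P 0 → ∀ {d} → IsLeast (P ∘ suc) d → IsLeast P (suc d)
IsLeast-suc {P = P} ¬P0 {d} (Pd , min) = Pd , min′
  where
  min′ : ∀ e → P e → suc d ≤ e
  min′ zero    P0 = contradiction P0 ¬P0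
  min′ (suc e) Pe = s≤s (min e Pe)

-- Used for the gaps of the Beatty cycle, where no return occurs before `q` steps and one occurs
-- after `q` or `suc q`.
IsLeast-consecutive : {P : Pred ℕ a} → ∀ {d q} → IsLeast P d → (∀ e → e < q → ¬ P e) →
                      P q ⊎ P (suc q) → d ≡ q ⊎ d ≡ suc q
IsLeast-consecutive {d = d} {q} (Pd , min) low next =
  Sum.map₁ (λ d<1+q → ≤-antisym (s≤s⁻¹ d<1+q) q≤d) (m≤n⇒m<n∨m≡n d≤1+q)
  where
  q≤d : q ≤ d
  q≤d = ≮⇒≥ (λ d<q → low d d<q Pd)

  d≤1+q : d ≤ suc q
  d≤1+q = [ (λ Pq → m≤n⇒m≤1+n (min q Pq)) , min (suc q) ]′ next

-- Sums over lists.

sum-const : ∀ (xs : List A) c → sum (map (const c) xs) ≡ length xs * c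
sum-const []       c = refl
sum-const (_ ∷ xs) c = cong (λ z → c + z) (sum-const xs c)

sum-mono : {f g : A → ℕ} {xs : List A} → All (λ x → f x ≤ g x) xs → sum (map f xs) ≤ sum (map g xs)
sum-mono []       = z≤n
sum-mono (p ∷ ps) = +-mono-≤ p (sum-mono ps)

sum-*ˡ : ∀ c (f : A → ℕ) xs → sum (map (λ x → c * f x) xs) ≡ c * sum (map f xs)
sum-*ˡ c f []       = sym (*-zeroʳ c)
sum-*ˡ c f (x ∷ xs) = trans (cong (λ z → _ + z) (sum-*ˡ c f xs)) (sym (*-distribˡ-+ c (f x) _))

sum-+const : ∀ (f : A → ℕ) c xs → sum (map (λ x → f x + c) xs) ≡ sum (map f xs) + length xs * c
sum-+const f c []       = refl
sum-+const f c (x ∷ xs) = trans (cong (λ z → _ + z) (sum-+const f c xs)) (interchange (f x) c _ _)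
  where
  interchange : ∀ w x y z → w + x + (y + z) ≡ w + y + (x + z)
  interchange = solve-∀

-- Summing f over the entries satisfying P, when f i = c + G (i + 1) − G i at those
-- entries and 0 = c + G (i + 1) − G i at the others.
telescope : {P : Pred A p} (P? : Decidable P) (f : A → ℕ) (c : ℕ) (h : Fin n → A) (G : ℕ → ℕ) →
            (∀ i → P (h i) → f (h i) + G (toℕ i) ≡ c + G (suc (toℕ i))) →
            (∀ i → ¬ P (h i) → G (toℕ i) ≡ c + G (suc (toℕ i))) →
            sum (map f (filter P? (tabulate h))) + G 0 ≡ n * c + G n
telescope {n = zero}  P? f c h G in-P out-P = refl
telescope {n = suc n} P? f c h G in-P out-P
  with P? (h zero) | telescope P? f c (h ∘ suc) (G ∘ suc) (in-P ∘ suc) (out-P ∘ suc)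
... | yes Ph₀ | ih = begin
  f (h zero) + S + G 0    ≡⟨ move (f (h zero)) S (G 0) ⟩
  f (h zero) + G 0 + S    ≡⟨ cong (_+ S) (in-P zero Ph₀) ⟩
  c + G 1 + S             ≡⟨ rotate c (G 1) S ⟩
  c + (S + G 1)           ≡⟨ cong (λ z → c + z) ih ⟩
  c + (n * c + G (suc n)) ≡⟨ +-assoc c (n * c) _ ⟨
  c + n * c + G (suc n)   ∎
  where
  open ≡-Reasoning
  S = sum (map f (filter P? (tabulate (h ∘ suc))))
  move : ∀ x y z → x + y + z ≡ x + z + y
  move = solve-∀
  rotate : ∀ x y z → x + y + z ≡ x + (z + y)
  rotate = solve-∀
... | no ¬Ph₀ | ih = begin
  S + G 0                 ≡⟨ cong (λ z → S + z) (out-P zero ¬Ph₀) ⟩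
  S + (c + G 1)           ≡⟨ move S c (G 1) ⟩
  c + (S + G 1)           ≡⟨ cong (λ z → c + z) ih ⟩
  c + (n * c + G (suc n)) ≡⟨ +-assoc c (n * c) _ ⟨
  c + n * c + G (suc n)   ∎
  where
  open ≡-Reasoning
  S = sum (map f (filter P? (tabulate (h ∘ suc))))
  move : ∀ x y z → x + (y + z) ≡ y + (x + z)
  move = solve-∀

-- Counting list entries by two disjoint predicates.

module _ {P : Pred A a} {Q : Pred A b} (P? : Decidable P) (Q? : Decidable Q)
         (disjoint : ∀ x → P x → ¬ Q x) where

  length-filter-∪ : ∀ xs → length (filter P? xs) + length (filter Q? xs) ≡
                           length (filter (P? ∪? Q?) xs)
  length-filter-∪ []       = refl
  length-filter-∪ (x ∷ xs) with P? x | Q? x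
  ... | yes Px | yes Qx = contradiction Qx (disjoint x Px)
  ... | yes _  | no  _  = cong suc (length-filter-∪ xs)
  ... | no  _  | yes _  = trans (+-suc _ _) (cong suc (length-filter-∪ xs))
  ... | no  _  | no  _  = length-filter-∪ xs

  All⇒length-filter : ∀ {xs} → All (P ∪ Q) xs →
                      length (filter P? xs) + length (filter Q? xs) ≡ length xs
  All⇒length-filter {xs} all =
    trans (length-filter-∪ xs) (cong length (filter-all (P? ∪? Q?) all))

  -- An entry satisfying neither predicate would make the list filtered by their union strictly
  -- shorter than `xs`.
  length-filter⇒All : ∀ xs → length (filter P? xs) + length (filter Q? xs) ≡ length xs →
                      All (P ∪ Q) xs
  length-filter⇒All xs eq with All.all? (P? ∪? Q?) xs
  ... | yes all = all
  ... | no ¬all = contradiction (trans (sym (length-filter-∪ xs)) eq)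
        (<⇒≢ (filter-notAll (P? ∪? Q?) xs (¬All⇒Any¬ (P? ∪? Q?) xs ¬all)))

-- Every entry contributes `q`, and those equal to `z` one more. The value `z` stays an integer,
-- tied to `suc q` only by an equation, so that the filter applies verbatim to `u k`.
sum-consecutive : ∀ (f : A → ℕ) q {z} → z ≡ + suc q → ∀ {xs} →
                  All (λ x → + f x ≡ + q ⊎ + f x ≡ z) xs →
                  sum (map f xs) ≡ length (filter (λ x → + f x ℤ.≟ z) xs) + length xs * q
sum-consecutive f q z≡1+q [] = refl
sum-consecutive f q {z} z≡1+q {x ∷ xs} (fx ∷ all) with + f x ℤ.≟ z | fx
... | yes fx≡z | _ =
  trans (cong₂ _+_ (ℤ.+-injective (trans fx≡z z≡1+q)) (sum-consecutive f q z≡1+q all))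
        (move q (length (filter _ xs)) _)
  where
  move : ∀ x y z → suc x + (y + z) ≡ suc y + (x + z)
  move = solve-∀
... | no _ | inj₁ fx≡q =
  trans (cong₂ _+_ (ℤ.+-injective fx≡q) (sum-consecutive f q z≡1+q all))
        (move q (length (filter _ xs)) _)
  where
  move : ∀ x y z → x + (y + z) ≡ y + (x + z)
  move = solve-∀
... | no fx≢z | inj₂ fx≡z = contradiction fx≡z fx≢z

-- The quadratic inequality behind the bound on second moments.

consecutive-≤ : ∀ q d → (q + suc q) * d ≤ d ^ 2 + q * suc q
consecutive-≤ q d with ≤-<-connex d q
-- In both cases the slack `(d - q)(d - q - 1)` equals `e * suc e`: first with `q = d + e`, then
-- with `d = suc q + e`.
... | inj₁ d≤q with e , refl ← m≤n⇒∃[o]m+o≡n d≤q =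
  m+n≤o⇒m≤o _ (≤-reflexive (identity d e))
  where
  identity : ∀ d e → (d + e + suc (d + e)) * d + e * suc e ≡ d * (d * 1) + (d + e) * suc (d + e)
  identity = solve-∀
... | inj₂ q<d with e , refl ← m≤n⇒∃[o]m+o≡n q<d =
  m+n≤o⇒m≤o _ (≤-reflexive (identity q e))
  where
  identity : ∀ q e → (q + suc q) * (suc q + e) + e * suc e ≡
                     (suc q + e) * ((suc q + e) * 1) + q * suc q
  identity = solve-∀

consecutive-≡ : ∀ q d → d ≡ q ⊎ d ≡ suc q → d ^ 2 + q * suc q ≡ (q + suc q) * d
consecutive-≡ q _ (inj₁ refl) = identity q
  where
  identity : ∀ q → q * (q * 1) + q * suc q ≡ (q + suc q) * q
  identity = solve-∀
consecutive-≡ q _ (inj₂ refl) = identity q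
  where
  identity : ∀ q → suc q * (suc q * 1) + q * suc q ≡ (q + suc q) * suc q
  identity = solve-∀

sum-squares-≥ : ∀ (f : A → ℕ) q xs → (q + suc q) * sum (map f xs) ≤
                sum (map (λ x → f x ^ 2) xs) + length xs * (q * suc q)
sum-squares-≥ f q xs = subst₂ _≤_ (sum-*ˡ (q + suc q) f xs) (sum-+const (λ x → f x ^ 2) _ xs)
  (sum-mono (All.universal (λ x → consecutive-≤ q (f x)) xs))

sum-squares-≤ : ∀ (f : A → ℕ) q {xs} → All (λ x → f x ≡ q ⊎ f x ≡ suc q) xs →
                sum (map (λ x → f x ^ 2) xs) + length xs * (q * suc q) ≤
                (q + suc q) * sum (map f xs)
sum-squares-≤ f q {xs} all = subst₂ _≤_ (sum-+const (λ x → f x ^ 2) _ xs) (sum-*ˡ (q + suc q) f xs)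
  (sum-mono (All.map (λ {x} fx → ≤-reflexive (consecutive-≡ q (f x) fx)) all))

-- Floors, ceilings and differences: from integers to naturals.

floor-/ : ∀ n d .{{_ : NonZero d}} → floor (+ n ℚᵘ./ d) ≡ + (n / d)
floor-/ n (suc d) = ℤ.*-identityˡ _

-- The ceiling is minus the floor of the negated fraction, and rounding a negative quotient down
-- costs an extra 1 when the remainder is nonzero.
ceiling-/ : ∀ n d .{{_ : NonZero d}} → d ∤ n → ceiling (+ n ℚᵘ./ d) ≡ + suc (n / d)
ceiling-/ zero    (suc d) d∤n = contradiction (m%n≡0⇒n∣m 0 (suc d) refl) d∤n
ceiling-/ (suc n) (suc d) d∤n with suc n % suc d in eq
... | zero  = contradiction (m%n≡0⇒n∣m (suc n) (suc d) eq) d∤n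
... | suc _ = cong ℤ.-_ (ℤ.*-identityˡ ℤ.-[1+ suc n / suc d ])

/-monoˡ-≤-ℚᵘ : ∀ {a b} d .{{_ : NonZero d}} → a ≤ b → + a ℚᵘ./ d ℚᵘ.≤ + b ℚᵘ./ d
/-monoˡ-≤-ℚᵘ (suc d) a≤b = ℚᵘ.*≤* (ℤ.*-monoʳ-≤-nonNeg (+ suc d) (ℤ.+≤+ a≤b))

-- The prescribed counts are integer differences; additive equations between naturals avoid
-- truncated subtraction.
m+n≡o⇒+m≡+o-+n : ∀ {m n o} → m + n ≡ o → + m ≡ + o ℤ.- + n
m+n≡o⇒+m≡+o-+n {m} {n} refl = begin
  + m                 ≡⟨ cong +_ (m+n∸n≡m m n) ⟨
  + (m + n ∸ n)       ≡⟨ ℤ.⊖-≥ (m≤n+m n m) ⟨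
  m + n ℤ.⊖ n         ≡⟨ ℤ.m-n≡m⊖n (m + n) n ⟨
  + (m + n) ℤ.- + n   ∎
  where open ≡-Reasoning

+m≡+o-+n⇒m+n≡o : ∀ {m n o} → + m ≡ + o ℤ.- + n → m + n ≡ o
+m≡+o-+n⇒m+n≡o {m} {n} {o} eq = ℤ.+-injective (begin
  + m ℤ.+ + n                  ≡⟨ cong (ℤ._+ + n) eq ⟩
  + o ℤ.- + n ℤ.+ + n          ≡⟨ ℤ.+-assoc (+ o) (ℤ.- + n) (+ n) ⟩
  + o ℤ.+ (ℤ.- + n ℤ.+ + n)    ≡⟨ cong (λ z → + o ℤ.+ z) (ℤ.+-inverseˡ (+ n)) ⟩
  + o ℤ.+ + 0                  ≡⟨ ℤ.+-identityʳ (+ o) ⟩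
  + o                          ∎)
  where open ≡-Reasoning

[m+kn]/n≡k : ∀ {m} k n .{{_ : NonZero n}} → m < n → (m + k * n) / n ≡ k
[m+kn]/n≡k {m} k n m<n = begin
  (m + k * n) / n   ≡⟨ +-distrib-/-∣ʳ m (n∣m*n k) ⟩
  m / n + k * n / n ≡⟨ cong₂ _+_ (m<n⇒m/n≡0 m<n) (m*n/n≡m k n) ⟩
  k                 ∎
  where open ≡-Reasoning

-- Cycles, waiting distances and the sum of the gaps.

module _ {n : ℕ} .{{_ : NonZero n}} (P : CyclicSequencingProblem n) where
  open CyclicSequencingProblem P

  at-cong-% : ∀ C a b → a % N ≡ b % N → at C a ≡ at C b
  at-cong-% C a b eq = cong C (Fin.toℕ-injective
    (trans (Fin.toℕ-fromℕ< (m%n<n a N)) (trans eq (sym (Fin.toℕ-fromℕ< (m%n<n b N))))))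

  at-toℕ : ∀ C i → at C (toℕ i) ≡ C i
  at-toℕ C i = cong C (Fin.toℕ-injective
    (trans (Fin.toℕ-fromℕ< (m%n<n (toℕ i) N)) (m<n⇒m%n≡m (Fin.toℕ<n i))))

  instance-exists : ∀ C k → Admissible C → ∃ λ j → C j ≡ k
  instance-exists C k adm with instances C k | all-filter (λ j → C j Fin.≟ k) (allFin N) | adm k
  ... | []    | _      | 0≡m = contradiction (sym 0≡m) (≢-nonZero⁻¹ (m k))
  ... | j ∷ _ | Cj ∷ _ | _   = j , Cj

  -- With g j the distance from position j to the first instance at or after j,
  -- an instance has Δ_j = 1 + g (j + 1) and g j = 0, whereas any other position
  -- has g j = 1 + g (j + 1).
  module _ (C : Cycle) (k : Fin n) (adm : Admissible C) where

    Wait : ℕ → Pred ℕ _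
    Wait a d = at C (a + d) ≡ k

    wait : ∀ a → ∃ (IsLeast (Wait a))
    wait a with j , Cj ← instance-exists C k adm =
      -- The search limit: from `a` this distance leads to `toℕ j + a * N`, which is position `j`
      -- modulo `N`. Truncated subtraction is exact since `a ≤ a * N`.
      least (λ d → at C (a + d) Fin.≟ k) (toℕ j + (a * N ∸ a))
        (trans (at-cong-% C _ (toℕ j) (trans (cong (_% N) eq) ([m+kn]%n≡m%n (toℕ j) a N)))
               (trans (at-toℕ C j) Cj))
      where
      move : ∀ x y z → x + (y + z) ≡ y + (x + z)
      move = solve-∀
      eq : ∀ {j} → a + (j + (a * N ∸ a)) ≡ j + a * N
      eq {j} = trans (move a j _) (cong (λ z → j + z) (m+[n∸m]≡n (m≤m*n a N)))

    g : ℕ → ℕ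
    g = proj₁ ∘ wait

    g-periodic : g N ≡ g 0
    g-periodic = IsLeast-unique (λ d → trans (sym (shift d))) (λ d → trans (shift d))
                   (proj₂ (wait N)) (proj₂ (wait 0))
      where
      shift : ∀ d → at C (N + d) ≡ at C d
      shift d = at-cong-% C (N + d) d (trans (cong (_% N) (+-comm N d)) ([m+n]%n≡m%n d N))

    g-instance : ∀ i → C i ≡ k → g (toℕ i) ≡ 0
    g-instance i Ci = n≤0⇒n≡0 (proj₂ (proj₂ (wait (toℕ i))) 0
      (trans (cong (at C) (+-identityʳ (toℕ i))) (trans (at-toℕ C i) Ci)))

    g-noninstance : ∀ i → C i ≢ k → g (toℕ i) ≡ suc (g (suc (toℕ i)))
    g-noninstance i Ci≢k = IsLeast-unique (λ _ → id) (λ _ → id) (proj₂ (wait (toℕ i)))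
      (IsLeast-suc {P = Wait (toℕ i)}
        (λ w → Ci≢k (trans (sym (at-toℕ C i)) (trans (cong (at C) (sym (+-identityʳ (toℕ i)))) w)))
        (trans (cong (at C) (+-suc (toℕ i) _)) (proj₁ least₁) ,
         λ e w → proj₂ least₁ e (trans (cong (at C) (sym (+-suc (toℕ i) e))) w)))
      where
      least₁ = proj₂ (wait (suc (toℕ i)))

    Δ-instance : ∀ i → C i ≡ k → Δ C i ≡ suc (g (suc (toℕ i)))
    Δ-instance i Ci = IsLeast-unique (λ _ → id) (λ _ → id) (proj₂ (next C i))
      (IsLeast-suc {P = Recurs C i} (λ ())
        ((s≤s z≤n , trans (cong (at C) (+-suc (toℕ i) _)) (trans (proj₁ least₁) (sym Ci))) ,
         λ e r → proj₂ least₁ e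
           (trans (cong (at C) (sym (+-suc (toℕ i) e))) (trans (proj₂ r) Ci))))
      where
      least₁ = proj₂ (wait (suc (toℕ i)))

    -- Each position, instance or not, accounts for one step when the waiting distances `g`
    -- telescope, and the boundary terms `g 0` and `g N` cancel.
    sum-Δ : sum (map (Δ C) (instances C k)) ≡ N
    sum-Δ = +-cancelʳ-≡ (g 0) _ _ (begin
      sum (map (Δ C) (instances C k)) + g 0 ≡⟨ telescope (λ j → C j Fin.≟ k) (Δ C) 1 id g
                                                 in-J g-noninstance ⟩
      N * 1 + g N                           ≡⟨ cong₂ _+_ (*-identityʳ N) g-periodic ⟩
      N + g 0                               ∎)
      where
      open ≡-Reasoning
      in-J : ∀ i → C i ≡ k → Δ C i + g (toℕ i) ≡ 1 + g (suc (toℕ i))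
      in-J i Ci = trans (cong₂ _+_ (Δ-instance i Ci) (g-instance i Ci)) (+-identityʳ _)

  -- Balanced gap counts and minimality of the second moment.

  module _ (k : Fin n) (m∤N : m k ∤ N) where

    q : ℕ
    q = N / m k

    ℓ≡q : ℓ k ≡ + q
    ℓ≡q = floor-/ N (m k)

    u≡1+q : u k ≡ + suc q
    u≡1+q = ceiling-/ N (m k) m∤N

    ℓ≢u : ∀ {z} → z ≡ ℓ k → z ≢ u k
    ℓ≢u refl ℓ≡u = 1+n≢n (sym (ℤ.+-injective (trans (sym ℓ≡q) (trans ℓ≡u u≡1+q))))

    Nℓ≡ : Nℓ k ≡ + (m k * suc q) ℤ.- + N
    Nℓ≡ = cong (ℤ._- + N) (trans (cong (λ z → + m k ℤ.* z) u≡1+q) (sym (ℤ.pos-* (m k) (suc q))))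

    Nu≡ : Nu k ≡ + N ℤ.- + (m k * q)
    Nu≡ = cong (λ z → + N ℤ.- z) (trans (cong (λ z → + m k ℤ.* z) ℓ≡q) (sym (ℤ.pos-* (m k) q)))

    -- Pivot of both claims: for an admissible cycle it is equivalent to `Balanced`, yet it
    -- constrains each gap separately, as the termwise estimate needs.
    EvenlySpaced : Cycle → Set
    EvenlySpaced C = All (λ j → + Δ C j ≡ ℓ k ⊎ + Δ C j ≡ u k) (instances C k)

    -- The prescribed counts add up to `m k * (u k - ℓ k) = m k`, the number of instances, so no
    -- instance is left with another gap.
    Balanced⇒EvenlySpaced : ∀ C → Admissible C → Balanced C k → EvenlySpaced C
    Balanced⇒EvenlySpaced C adm (#ℓ , #u) =
      length-filter⇒All (λ j → + Δ C j ℤ.≟ ℓ k) (λ j → + Δ C j ℤ.≟ u k) (λ _ → ℓ≢u)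
        (instances C k) (trans x+y≡m (sym (adm k)))
      where
      open ≡-Reasoning
      x = countΔ C k (ℓ k)
      y = countΔ C k (u k)
      move : ∀ x y z w → x + y + (z + w) ≡ x + z + (y + w)
      move = solve-∀
      factor : ∀ m q N → m * suc q + N ≡ m + (N + m * q)
      factor = solve-∀
      x+y≡m : x + y ≡ m k
      x+y≡m = +-cancelʳ-≡ (N + m k * q) _ _ (begin
        x + y + (N + m k * q) ≡⟨ move x y N _ ⟩
        x + N + (y + m k * q) ≡⟨ cong₂ _+_ (+m≡+o-+n⇒m+n≡o (trans #ℓ Nℓ≡))
                                           (+m≡+o-+n⇒m+n≡o (trans #u Nu≡)) ⟩
        m k * suc q + N       ≡⟨ factor (m k) q N ⟩
        m k + (N + m k * q)   ∎)

    -- Two linear equations fix the counts: `x + y = m k`, and `y + m k * q = N` because the gaps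
    -- sum to `N` and each long one exceeds `q` by one.
    EvenlySpaced⇒Balanced : ∀ C → Admissible C → EvenlySpaced C → Balanced C k
    EvenlySpaced⇒Balanced C adm even =
      trans (m+n≡o⇒+m≡+o-+n x+N≡m*[1+q]) (sym Nℓ≡) , trans (m+n≡o⇒+m≡+o-+n y+mq≡N) (sym Nu≡)
      where
      open ≡-Reasoning
      x = countΔ C k (ℓ k)
      y = countΔ C k (u k)
      x+y≡m : x + y ≡ m k
      x+y≡m = trans (All⇒length-filter (λ j → + Δ C j ℤ.≟ ℓ k) (λ j → + Δ C j ℤ.≟ u k)
                       (λ _ → ℓ≢u) even) (adm k)
      y+mq≡N : y + m k * q ≡ N
      y+mq≡N = begin
        y + m k * q                     ≡⟨ cong (λ z → y + z * q) (adm k) ⟨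
        y + length (instances C k) * q  ≡⟨ sum-consecutive (Δ C) q u≡1+q
                                             (All.map (Sum.map₁ (λ eq → trans eq ℓ≡q)) even) ⟨
        sum (map (Δ C) (instances C k)) ≡⟨ sum-Δ C k adm ⟩
        N                               ∎
      x+N≡m*[1+q] : x + N ≡ m k * suc q
      x+N≡m*[1+q] = begin
        x + N             ≡⟨ cong (λ z → x + z) y+mq≡N ⟨
        x + (y + m k * q) ≡⟨ +-assoc x y _ ⟨
        x + y + m k * q   ≡⟨ cong (_+ m k * q) x+y≡m ⟩
        m k + m k * q     ≡⟨ *-suc (m k) q ⟨
        m k * suc q       ∎

    -- All admissible cycles share the value `(q + suc q) * N`, since their gaps sum to `N`. Once
    -- the constant `m k * (q * suc q)` is added to the sums of squares, this value is attained by
    -- `C` and is a lower bound for `C′`.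
    EvenlySpaced⇒MinimizesSubMoment : ∀ C → Admissible C → EvenlySpaced C →
                                      MinimizesSubMoment 2 C k
    EvenlySpaced⇒MinimizesSubMoment C adm even C′ adm′ =
      /-monoˡ-≤-ℚᵘ N (+-cancelʳ-≤ (m k * (q * suc q)) _ _ (begin
        S C + m k * (q * suc q)                       ≡⟨ cong (λ z → S C + z * (q * suc q)) (adm k) ⟨
        S C + length (instances C k) * (q * suc q)    ≤⟨ sum-squares-≤ (Δ C) q
                                                           (All.map (Sum.map Δ≡q Δ≡1+q) even) ⟩
        (q + suc q) * sum (map (Δ C) (instances C k)) ≡⟨ cong ((q + suc q) *_)
                                                           (trans (sum-Δ C k adm) (sym (sum-Δ C′ k adm′))) ⟩
        (q + suc q) * sum (map (Δ C′) (instances C′ k)) ≤⟨ sum-squares-≥ (Δ C′) q (instances C′ k) ⟩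
        S C′ + length (instances C′ k) * (q * suc q)  ≡⟨ cong (λ z → S C′ + z * (q * suc q)) (adm′ k) ⟩
        S C′ + m k * (q * suc q)                      ∎))
      where
      open ≤-Reasoning
      S : Cycle → ℕ
      S C = sum (map (λ j → Δ C j ^ 2) (instances C k))
      Δ≡q : ∀ {d} → + d ≡ ℓ k → d ≡ q
      Δ≡q eq = ℤ.+-injective (trans eq ℓ≡q)
      Δ≡1+q : ∀ {d} → + d ≡ u k → d ≡ suc q
      Δ≡1+q eq = ℤ.+-injective (trans eq u≡1+q)

-- Alphabets with two symbols.

choose : Dec A → Fin 2 → Fin 2
choose (yes _) k = k
choose (no _)  k = opposite k

opposite-≢ : ∀ (k : Fin 2) → opposite k ≢ k
opposite-≢ zero       ()
opposite-≢ (suc zero) ()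

k⊎opposite : ∀ (k j : Fin 2) → j ≡ k ⊎ j ≡ opposite k
k⊎opposite zero       zero       = inj₁ refl
k⊎opposite zero       (suc zero) = inj₂ refl
k⊎opposite (suc zero) zero       = inj₂ refl
k⊎opposite (suc zero) (suc zero) = inj₁ refl

choose-⇒ : ∀ (A? : Dec A) k → choose A? k ≡ k → A
choose-⇒ (yes a) k eq = a
choose-⇒ (no ¬a) k eq = contradiction eq (opposite-≢ k)

choose-⇐ : ∀ (A? : Dec A) k → A → choose A? k ≡ k
choose-⇐ (yes _) k a = refl
choose-⇐ (no ¬a) k a = contradiction a ¬a

lookup-opposite : ∀ (v : Vec ℕ 2) k → lookup v k + lookup v (opposite k) ≡ Vec.sum v
lookup-opposite (x ∷ y ∷ []) zero       = cong (λ z → x + z) (sym (+-identityʳ y))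
lookup-opposite (x ∷ y ∷ []) (suc zero) = trans (+-comm y x) (cong (λ z → x + z) (sym (+-identityʳ y)))

-- The Beatty cycle: admissibility and gaps.

module _ (P : CyclicSequencingProblem 2) (k : Fin 2) where
  open CyclicSequencingProblem P

  -- N ≤ (j m mod N) + m says that ⌊j m / N⌋ increases from j to j + 1.
  Jump : Pred ℕ _
  Jump j = N ≤ (j * m k) % N + m k

  jump? : Decidable Jump
  jump? j = N ≤? (j * m k) % N + m k

  beatty : Cycle
  beatty i = choose (jump? (toℕ i)) k

  beatty-⇒ : ∀ i → beatty i ≡ k → Jump (toℕ i)
  beatty-⇒ i = choose-⇒ (jump? (toℕ i)) k

  beatty-⇐ : ∀ i → Jump (toℕ i) → beatty i ≡ k
  beatty-⇐ i = choose-⇐ (jump? (toℕ i)) k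

  -- Makes `Jump` depend only on the position modulo `N`, so that it can be tested at positions
  -- beyond the end of the cycle.
  mod-residue : ∀ a → (toℕ (a mod N) * m k) % N ≡ (a * m k) % N
  mod-residue a = begin
    (toℕ (a mod N) * m k) % N       ≡⟨ cong (λ x → (x * m k) % N) (Fin.toℕ-fromℕ< (m%n<n a N)) ⟩
    (a % N * m k) % N               ≡⟨ %-distribˡ-* (a % N) (m k) N ⟩
    (a % N % N * (m k % N)) % N     ≡⟨ cong (λ x → (x * (m k % N)) % N) (m%n%n≡m%n a N) ⟩
    (a % N * (m k % N)) % N         ≡⟨ %-distribˡ-* a (m k) N ⟨
    (a * m k) % N                   ∎
    where open ≡-Reasoning

  at-beatty-⇒ : ∀ a → at beatty a ≡ k → Jump a
  at-beatty-⇒ a eq = subst (λ t → N ≤ t + m k) (mod-residue a) (beatty-⇒ (a mod N) eq)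

  at-beatty-⇐ : ∀ a → Jump a → at beatty a ≡ k
  at-beatty-⇐ a jump =
    beatty-⇐ (a mod N) (subst (λ t → N ≤ t + m k) (sym (mod-residue a)) jump)

  m≤N : m k ≤ N
  m≤N = subst (m k ≤_) (lookup-opposite multiplicities k) (m≤m+n (m k) _)

  module AfterJump (j : ℕ) (jump : Jump j) where
    -- The residue of `suc j * m k` modulo `N`. Adding `m k` to the residue at `j` wraps around
    -- once, which leaves `s` below `m k`.
    s : ℕ
    s = proj₁ (m≤n⇒∃[o]m+o≡n jump)

    N+s≡ : N + s ≡ (j * m k) % N + m k
    N+s≡ = proj₂ (m≤n⇒∃[o]m+o≡n jump)

    s<m : s < m k
    s<m = +-cancelˡ-< N s (m k) (subst (_< N + m k) (sym N+s≡) (+-monoˡ-< (m k) (m%n<n (j * m k) N)))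

    position : ∀ d → (j + suc d) * m k ≡ s + d * m k + suc ((j * m k) / N) * N
    position d = begin
      (j + suc d) * m k                 ≡⟨ expand j d (m k) ⟩
      j * m k + (m k + d * m k)         ≡⟨ cong (_+ (m k + d * m k)) (m≡m%n+[m/n]*n (j * m k) N) ⟩
      t + Q * N + (m k + d * m k)       ≡⟨ regroup t (Q * N) (m k) (d * m k) ⟩
      t + m k + (d * m k + Q * N)       ≡⟨ cong (_+ (d * m k + Q * N)) N+s≡ ⟨
      N + s + (d * m k + Q * N)         ≡⟨ regroup′ N s (d * m k) (Q * N) ⟩
      s + d * m k + suc Q * N           ∎
      where
      open ≡-Reasoning
      t = (j * m k) % N
      Q = (j * m k) / N
      expand : ∀ j d m → (j + suc d) * m ≡ j * m + (m + d * m)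
      expand = solve-∀
      regroup : ∀ t x m y → t + x + (m + y) ≡ t + m + (y + x)
      regroup = solve-∀
      regroup′ : ∀ N s x y → N + s + (x + y) ≡ s + x + (N + y)
      regroup′ = solve-∀

    residue : ∀ d → s + d * m k < N → ((j + suc d) * m k) % N ≡ s + d * m k
    residue d <N = trans (cong (_% N) (position d))
      (trans ([m+kn]%n≡m%n (s + d * m k) (suc ((j * m k) / N)) N) (m<n⇒m%n≡m <N))

    -- After the jump at `j` the residues run through `s`, `s + m k`, `s + 2 * m k` and so on, until
    -- adding `m k` once more reaches `N`, which is the next jump. The hypothesis says that no
    -- further wrap has occurred by position `j + suc d`.
    jump-⇔ : ∀ d → s + d * m k < N → (Jump (j + suc d) → N ≤ s + suc d * m k) ×
                                     (N ≤ s + suc d * m k → Jump (j + suc d))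
    jump-⇔ d <N = subst (N ≤_) eq , subst (N ≤_) (sym eq)
      where
      move : ∀ s x m → s + x + m ≡ s + (m + x)
      move = solve-∀
      eq : ((j + suc d) * m k) % N + m k ≡ s + suc d * m k
      eq = trans (cong (_+ m k) (residue d <N)) (move s (d * m k) (m k))

    below : ∀ d → suc d * m k ≤ N → s + d * m k < N
    below d ≤N = <-≤-trans (+-monoˡ-< (d * m k) s<m) ≤N

  -- By `position 0` the new product is `s` plus a multiple of `N` one higher than before, and
  -- `s < m k ≤ N` makes `s` the remainder.
  quotient-jump : ∀ j → Jump j → suc ((j * m k) / N) ≡ (suc j * m k) / N
  quotient-jump j jump = sym (begin
    (suc j * m k) / N                               ≡⟨ cong (λ x → (x * m k) / N) (+-comm j 1) ⟨
    ((j + 1) * m k) / N                             ≡⟨ cong (_/ N) (position 0) ⟩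
    (s + 0 * m k + suc ((j * m k) / N) * N) / N     ≡⟨ [m+kn]/n≡k _ N
                                                        (below 0 (subst (_≤ N) (sym (*-identityˡ (m k))) m≤N)) ⟩
    suc ((j * m k) / N)                             ∎)
    where
    open ≡-Reasoning
    open AfterJump j jump

  quotient-no-jump : ∀ j → ¬ Jump j → (j * m k) / N ≡ (suc j * m k) / N
  quotient-no-jump j ¬jump = sym (begin
    (m k + j * m k) / N                                 ≡⟨ cong (λ x → (m k + x) / N) (m≡m%n+[m/n]*n (j * m k) N) ⟩
    (m k + ((j * m k) % N + (j * m k) / N * N)) / N     ≡⟨ cong (_/ N) (move (m k) ((j * m k) % N) _) ⟩
    ((j * m k) % N + m k + (j * m k) / N * N) / N       ≡⟨ [m+kn]/n≡k _ N (≰⇒> ¬jump) ⟩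
    (j * m k) / N                                       ∎)
    where
    open ≡-Reasoning
    move : ∀ x y z → x + (y + z) ≡ y + x + z
    move = solve-∀

  -- The quotients `(j * m k) / N` telescope from 0 to `m k`, rising by one exactly at the
  -- instances.
  beatty-count : length (instances beatty k) ≡ m k
  beatty-count = begin
    length js                            ≡⟨ *-identityʳ _ ⟨
    length js * 1                        ≡⟨ sum-const js 1 ⟨
    sum (map (const 1) js)               ≡⟨ +-identityʳ _ ⟨
    sum (map (const 1) js) + 0           ≡⟨ cong (λ z → sum (map (const 1) js) + z) (0/n≡0 N) ⟨
    sum (map (const 1) js) + (0 / N)     ≡⟨ telescope (λ j → beatty j Fin.≟ k) (const 1) 0 id
                                             (λ j → (j * m k) / N)
                                             (λ i Ci → quotient-jump (toℕ i) (beatty-⇒ i Ci))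
                                             (λ i Ci≢k → quotient-no-jump (toℕ i) (Ci≢k ∘ beatty-⇐ i)) ⟩
    N * 0 + (N * m k) / N                ≡⟨ cong₂ _+_ (*-zeroʳ N) (cong (_/ N) (*-comm N (m k))) ⟩
    (m k * N) / N                         ≡⟨ m*n/n≡m (m k) N ⟩
    m k                                  ∎
    where
    open ≡-Reasoning
    js = instances beatty k

  instances-sum : ∀ C → length (instances C k) + length (instances C (opposite k)) ≡ N
  instances-sum C = trans
    (All⇒length-filter (λ j → C j Fin.≟ k) (λ j → C j Fin.≟ opposite k)
      (λ _ Cj≡k Cj≡k′ → opposite-≢ k (trans (sym Cj≡k′) Cj≡k))
      (All.universal (λ j → k⊎opposite k (C j)) (allFin N)))
    (length-tabulate id)

  -- Only the count of `k` needs computing: with two symbols the other one occupies the remaining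
  -- `N - m k` positions, which is its multiplicity.
  beatty-admissible : Admissible beatty
  beatty-admissible j with k⊎opposite k j
  ... | inj₁ refl = beatty-count
  ... | inj₂ refl = +-cancelˡ-≡ (m k) _ _ (begin
    m k + length (instances beatty (opposite k))      ≡⟨ cong (_+ length (instances beatty (opposite k))) beatty-count ⟨
    length (instances beatty k) + length (instances beatty (opposite k)) ≡⟨ instances-sum beatty ⟩
    N                                                 ≡⟨ lookup-opposite multiplicities k ⟨
    m k + m (opposite k)                              ∎)
    where open ≡-Reasoning

  -- Let `q = N / m k`. For `e < q` the value `s + e * m k` is below `suc e * m k`, hence below `N`,
  -- so there is no return after `e` steps. After `suc q` steps at the latest there is one, because
  -- `suc q * m k` exceeds `N`.
  beatty-Δ : ∀ i → beatty i ≡ k → Δ beatty i ≡ N / m k ⊎ Δ beatty i ≡ suc (N / m k)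
  beatty-Δ i Ci = IsLeast-consecutive {P = Recurs beatty i} (proj₂ (next beatty i)) low
    (recurs-near _ refl)
    where
    open AfterJump (toℕ i) (beatty-⇒ i Ci)

    qm≤N : ∀ {d} → d ≤ N / m k → d * m k ≤ N
    qm≤N d≤q = ≤-trans (*-monoˡ-≤ (m k) d≤q) (m/n*n≤m N (m k))

    low : ∀ e → e < N / m k → ¬ Recurs beatty i e
    low (suc d) 1+d<q (_ , at≡) = <⇒≱ (below (suc d) (qm≤N 1+d<q))
      (proj₁ (jump-⇔ d (below d (qm≤N (<⇒≤ 1+d<q)))) (at-beatty-⇒ _ (trans at≡ Ci)))

    recurs : ∀ d → s + d * m k < N → N ≤ s + suc d * m k → Recurs beatty i (suc d)
    recurs d <N ≥N = s≤s z≤n , trans (at-beatty-⇐ _ (proj₂ (jump-⇔ d <N) ≥N)) (sym Ci)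

    N<[1+q]m : N < suc (N / m k) * m k
    N<[1+q]m = subst (_< suc (N / m k) * m k) (sym (m≡m%n+[m/n]*n N (m k)))
      (+-monoˡ-< (N / m k * m k) (m%n<n N (m k)))

    -- A variable stands for the quotient so that it can be matched; it is positive because
    -- `m k ≤ N`.
    recurs-near : ∀ q → q ≡ N / m k → Recurs beatty i q ⊎ Recurs beatty i (suc q)
    recurs-near zero    0≡q = contradiction (sym 0≡q) (m<n⇒n≢0 (m≥n⇒m/n>0 m≤N))
    recurs-near (suc d) 1+d≡q with N ≤? s + suc d * m k
    ... | yes ≥N = inj₁ (recurs d (below d (qm≤N (≤-reflexive 1+d≡q))) ≥N)
    ... | no  ≱N = inj₂ (recurs (suc d) (≰⇒> ≱N)
      (≤-trans (<⇒≤ (subst (λ q → N < suc q * m k) (sym 1+d≡q) N<[1+q]m)) (m≤n+m _ s)))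

  beatty-evenlySpaced : (m∤N : m k ∤ N) → EvenlySpaced P k m∤N beatty
  beatty-evenlySpaced m∤N = All.map
    (λ {i} Ci → Sum.map (λ eq → trans (cong +_ eq) (sym (ℓ≡q P k m∤N)))
                        (λ eq → trans (cong +_ eq) (sym (u≡1+q P k m∤N))) (beatty-Δ i Ci))
    (all-filter (λ j → beatty j Fin.≟ k) (allFin N))

lemma6 : (P : CyclicSequencingProblem 2) (k : Fin 2) →
    let open CyclicSequencingProblem P in
    m k ∤ N →
    (∃ λ C → Admissible C × Balanced C k) ×
    (∀ C → Admissible C → Balanced C k → MinimizesSubMoment 2 C k)
lemma6 P k m∤N =
  (beatty P k , beatty-admissible P k ,
   EvenlySpaced⇒Balanced P k m∤N _ (beatty-admissible P k) (beatty-evenlySpaced P k m∤N)) ,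
  λ C adm bal → EvenlySpaced⇒MinimizesSubMoment P k m∤N C adm
                  (Balanced⇒EvenlySpaced P k m∤N C adm bal)
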